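{- For every integer $n\geq 1$, $\mathrm{R}_3(\mathcal{B}_n)\leq \mathrm{RR}(\mathcal{B}_2:\mathcal{B}_n)\leq \mathrm{R}_3(\mathcal{B}_n)+n$.
   Context: $\mathcal{B}_N$ denotes the Boolean lattice of all subsets of $[N]$ ordered by inclusion. An induced copy of a poset $\mathcal{P}$ in a poset $\mathcal{Q}$ is the image of an injection $f:\mathcal{P}\to\mathcal{Q}$ with $f(X)\le f(Y)$ iff $X\le Y$. Monochromatic: all sets share a color; rainbow: pairwise distinct colors. $\mathrm{R}_k(\mathcal{P})$ is the smallest $n$ such that every coloring of $\mathcal{B}_n$ with $k$ colors contains a monochromatic induced copy of $\mathcal{P}$. $\mathrm{RR}(\mathcal{Q}:\mathcal{P})$ is the smallest $n$ such that every coloring (with any number of colors) of the sets of $\mathcal{B}_n$ contains a rainbow induced copy of $\mathcal{Q}$ or a monochromatic induced copy of $\mathcal{P}$. -}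

module Defs where

open import Data.Fin.Base using (Fin)
open import Data.Fin.Subset using (Subset)
open import Data.Fin.Subset.Properties using (⊆-poset)
open import Data.Nat.Base using (ℕ; _≤_)
open import Data.Product.Base using (_×_; ∃-syntax)
open import Data.Sum.Base using (_⊎_)
open import Function.Base using (_∘_)
open import Function.Definitions using (Injective)
open import Level using (Level; 0ℓ; _⊔_)
open import Relation.Binary.Bundles using (Poset)
open import Relation.Binary.Morphism.Structures using (IsOrderMonomorphism)
open import Relation.Binary.PropositionalEquality using (_≡_)

private
  variable
    c ℓ₁ ℓ₂ c′ ℓ₁′ ℓ₂′ ℓ : Level
    k n : ℕ

𝓑 : ℕ → Poset 0ℓ 0ℓ 0ℓ
𝓑 = ⊆-poset

-- The field `cancel` of IsOrderMonomorphism is the order-reflecting half of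
-- f X ≤ f Y ⇔ X ≤ Y.  The copy itself is the image of `embed`.
record InducedCopy (P : Poset c ℓ₁ ℓ₂) (Q : Poset c′ ℓ₁′ ℓ₂′)
                   : Set (c ⊔ ℓ₁ ⊔ ℓ₂ ⊔ c′ ⊔ ℓ₁′ ⊔ ℓ₂′) where
  private
    module P = Poset P
    module Q = Poset Q
  field
    embed               : P.Carrier → Q.Carrier
    isOrderMonomorphism : IsOrderMonomorphism P._≈_ Q._≈_ P._≤_ Q._≤_ embed

open InducedCopy public

-- A coloring need not use all k colors.
Coloring : ℕ → ℕ → Set
Coloring k n = Subset n → Fin k

Monochromatic : (P : Poset c ℓ₁ ℓ₂) → Coloring k n → InducedCopy P (𝓑 n) → Set c
Monochromatic P χ f = ∀ X Y → χ (embed f X) ≡ χ (embed f Y)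

-- Since `embed f` is injective, distinct elements of P are distinct sets of
-- the copy.
Rainbow : (P : Poset c ℓ₁ ℓ₂) → Coloring k n → InducedCopy P (𝓑 n) → Set (c ⊔ ℓ₁)
Rainbow P χ f = Injective (Poset._≈_ P) _≡_ (χ ∘ embed f)

RamseyProperty : ℕ → Poset c ℓ₁ ℓ₂ → ℕ → Set (c ⊔ ℓ₁ ⊔ ℓ₂)
RamseyProperty k P N =
  (χ : Coloring k N) → ∃[ f ] Monochromatic P χ f

-- "Any number of colors" is quantification over k.
RainbowRamseyProperty : Poset c ℓ₁ ℓ₂ → Poset c′ ℓ₁′ ℓ₂′ → ℕ →
                        Set (c ⊔ ℓ₁ ⊔ ℓ₂ ⊔ c′ ⊔ ℓ₁′ ⊔ ℓ₂′)
RainbowRamseyProperty Q P N =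
  (k : ℕ) (χ : Coloring k N) →
  (∃[ f ] Rainbow Q χ f) ⊎ (∃[ f ] Monochromatic P χ f)

IsSmallest : (ℕ → Set ℓ) → ℕ → Set ℓ
IsSmallest A n = A n × (∀ m → A m → n ≤ m)

-- The Ramsey numbers are given by their graphs: `R k [ P ]≔ r` reads R_k(P) = r
-- and `RR[ Q ∶ P ]≔ r` reads RR(Q : P) = r.
infix 4 R_[_]≔_ RR[_∶_]≔_

R_[_]≔_ : ℕ → Poset c ℓ₁ ℓ₂ → ℕ → Set (c ⊔ ℓ₁ ⊔ ℓ₂)
R k [ P ]≔ r = IsSmallest (RamseyProperty k P) r

RR[_∶_]≔_ : Poset c ℓ₁ ℓ₂ → Poset c′ ℓ₁′ ℓ₂′ → ℕ →
            Set (c ⊔ ℓ₁ ⊔ ℓ₂ ⊔ c′ ⊔ ℓ₁′ ⊔ ℓ₂′)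
RR[ Q ∶ P ]≔ r = IsSmallest (RainbowRamseyProperty Q P) r

{-# OPTIONS --safe #-}
-- Three colors admit no rainbow 𝓑 2, which gives the lower bound.  For the upper
-- bound, consider a coloring of 𝓑 N without a rainbow 𝓑 2 in which ⊥ and ⊤ have
-- different colors a and b: sets of two further colors are always comparable.  So
-- either at most one further color occurs, or two nested sets Y ⊂ Z carry further
-- colors; in the latter case the sets that contain some z ∉ Z and miss some y ∈ Y
-- form a cube of dimension N - 2 in the colors a and b.  Hence, if there is no
-- monochromatic 𝓑 n and N = r + n ≥ r + 2, all sets of size at least r + 2 have
-- the color of ⊥ and, dually, all sets of size at most n - 2 have the color of ⊤.
-- For n ≥ 3 these sets contain a monochromatic 𝓑 n.  The cases n = 1 and n = 2 are
-- treated separately, using r ≥ 3 n.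
module Submission where

open import Defs
open import Data.Bool.Properties using () renaming (_≟_ to _≟ᵇ_)
open import Data.Empty using (⊥-elim)
open import Data.Fin.Base using (Fin; zero; suc; fromℕ<; combine; punchOut)
open import Data.Fin.Properties using (_≟_; any?; combine-injective; fromℕ<-injective;
  injective⇒≤; punchOut-injective)
open import Data.Fin.Subset
open import Data.Fin.Subset.Properties
open import Data.Nat.Base using (ℕ; zero; suc; _≤_; _<_; _+_; _*_; _∸_; _^_; NonZero; z≤n; s≤s)
open import Data.Nat.DivMod using (_/_; m<n*o⇒m/o<n; /-monoˡ-≤; m/n≡1+[m∸n]/n)
import Data.Nat.Properties as ℕ
open import Data.Product.Base using (_×_; _,_; proj₁; proj₂; ∃; ∃-syntax; Σ-syntax; map₂)
open import Data.Sum.Base as Sum using (_⊎_; inj₁; inj₂)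
open import Data.Vec.Base using ([]; _∷_; _++_; here; there)
open import Data.Vec.Properties using (≡-dec)
open import Function.Base using (_∘_; id; const; case_of_)
open import Relation.Binary.Morphism.Construct.Composition using ()
  renaming (isOrderMonomorphism to ∘-isOrderMonomorphism)
open import Relation.Binary.Morphism.Structures using (module IsOrderMonomorphism)
open import Relation.Binary.PropositionalEquality
  using (_≡_; _≢_; _≗_; refl; sym; trans; cong; subst; subst₂)
open import Relation.Nullary using (Dec; yes; no; ¬_; ¬?; contradiction; _×-dec_; _⊎-dec_; _→-dec_)
open import Relation.Nullary.Decidable using (map′; decidable-stable)
open import Relation.Unary using (Decidable)

private
  variable
    k l m n r M N : ℕ
    s t : Side
    p p′ q q′ : Subset n

-- Subsets

∷-⊆ : s ∷ p ⊆ t ∷ q → p′ ⊆ q′ → s ∷ p′ ⊆ t ∷ q′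
∷-⊆ h h′ here with here ← h here = here
∷-⊆ h h′ (there i)               = there (h′ i)

++-⊆ : (p p′ : Subset m) → p ⊆ p′ → q ⊆ q′ → p ++ q ⊆ p′ ++ q′
++-⊆ []      []        h h′ = h′
++-⊆ (_ ∷ p) (_ ∷ p′) h h′ = ∷-⊆ h (++-⊆ p p′ (drop-∷-⊆ h) h′)

++-⊆⁻ˡ : (p p′ : Subset m) (q q′ : Subset n) → p ++ q ⊆ p′ ++ q′ → p ⊆ p′
++-⊆⁻ˡ []      []       q q′ h = id
++-⊆⁻ˡ (_ ∷ p) (_ ∷ p′) q q′ h = ∷-⊆ h (++-⊆⁻ˡ p p′ q q′ (drop-∷-⊆ h))

++-⊆⁻ʳ : (p p′ : Subset m) {q q′ : Subset n} → p ++ q ⊆ p′ ++ q′ → q ⊆ q′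
++-⊆⁻ʳ []      []       h = h
++-⊆⁻ʳ (_ ∷ p) (_ ∷ p′) h = ++-⊆⁻ʳ p p′ (drop-∷-⊆ h)

∣p++q∣≡∣p∣+∣q∣ : (p : Subset m) (q : Subset n) → ∣ p ++ q ∣ ≡ ∣ p ∣ + ∣ q ∣
∣p++q∣≡∣p∣+∣q∣ []            q = refl
∣p++q∣≡∣p∣+∣q∣ (outside ∷ p) q = ∣p++q∣≡∣p∣+∣q∣ p q
∣p++q∣≡∣p∣+∣q∣ (inside  ∷ p) q = cong suc (∣p++q∣≡∣p∣+∣q∣ p q)

∣p∪q∣≤∣p∣+∣q∣ : (p q : Subset n) → ∣ p ∪ q ∣ ≤ ∣ p ∣ + ∣ q ∣
∣p∪q∣≤∣p∣+∣q∣ []            []            = z≤n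
∣p∪q∣≤∣p∣+∣q∣ (outside ∷ p) (outside ∷ q) = ∣p∪q∣≤∣p∣+∣q∣ p q
∣p∪q∣≤∣p∣+∣q∣ (inside  ∷ p) (outside ∷ q) = s≤s (∣p∪q∣≤∣p∣+∣q∣ p q)
∣p∪q∣≤∣p∣+∣q∣ (outside ∷ p) (inside  ∷ q)
  rewrite ℕ.+-suc ∣ p ∣ ∣ q ∣ = s≤s (∣p∪q∣≤∣p∣+∣q∣ p q)
∣p∪q∣≤∣p∣+∣q∣ (inside  ∷ p) (inside  ∷ q)
  rewrite ℕ.+-suc ∣ p ∣ ∣ q ∣ = s≤s (ℕ.m≤n⇒m≤1+n (∣p∪q∣≤∣p∣+∣q∣ p q))

⊆∧⊉⇒⊂ : p ⊆ q → p ⊉ q → p ⊂ q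
⊆∧⊉⇒⊂ {p = p} {q = q} p⊆q q⊈p
  with any? (λ x → x ∈? q ×-dec ¬? (x ∈? p))
... | yes w = p⊆q , w
... | no ¬w = contradiction
  (λ {x} x∈q → decidable-stable (x ∈? p) (λ x∉p → ¬w (x , x∈q , x∉p))) q⊈p

-- Copies of Boolean lattices

Copy : ℕ → ℕ → Set
Copy m N = InducedCopy (𝓑 m) (𝓑 N)

Monotone Reflecting : (Subset m → Subset N) → Set
Monotone   f = ∀ X Y → X ⊆ Y → f X ⊆ f Y
Reflecting f = ∀ X Y → f X ⊆ f Y → X ⊆ Y

copy : (f : Subset m → Subset N) → Monotone f → Reflecting f → Copy m N
copy f mono reflect = record
  { embed               = f
  ; isOrderMonomorphism = record
    { isOrderHomomorphism = record { cong = cong f ; mono = mono _ _ }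
    ; injective           = λ eq → ⊆-antisym (reflect _ _ (⊆-reflexive eq))
                                             (reflect _ _ (⊆-reflexive (sym eq)))
    ; cancel              = reflect _ _
    }
  }

embed-mono : (φ : Copy m N) → Monotone (embed φ)
embed-mono φ X Y = IsOrderMonomorphism.mono (isOrderMonomorphism φ)

embed-reflect : (φ : Copy m N) → Reflecting (embed φ)
embed-reflect φ X Y = IsOrderMonomorphism.cancel (isOrderMonomorphism φ)

infixr 9 _⊙_

_⊙_ : Copy M N → Copy m M → Copy m N
φ ⊙ ψ = record
  { embed               = embed φ ∘ embed ψ
  ; isOrderMonomorphism = ∘-isOrderMonomorphism
      (isOrderMonomorphism ψ) (isOrderMonomorphism φ)
  }

identity : Copy n n
identity = copy id (λ _ _ → id) (λ _ _ → id)

cons : Side → Copy n (suc n)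
cons s = copy (s ∷_) (λ _ _ → s⊆s) (λ _ _ → drop-∷-⊆)

prepend : Subset m → Copy n (m + n)
prepend p = copy (p ++_) (λ _ _ → ++-⊆ p p id) (λ _ _ → ++-⊆⁻ʳ p p)

append : Subset n → Copy m (m + n)
append q = copy (_++ q) (λ X Y h → ++-⊆ X Y h id) (λ X Y → ++-⊆⁻ˡ X Y q q)

widen : m ≤ N → Copy m N
widen m≤N = copy (f m≤N) (mono m≤N) (reflect m≤N)
  where
  f : m ≤ N → Subset m → Subset N
  f z≤n     _       = ⊥
  f (s≤s h) (s ∷ X) = s ∷ f h X

  mono : (h : m ≤ N) → Monotone (f h)
  mono z≤n     _       _       _ = id
  mono (s≤s h) (_ ∷ X) (_ ∷ Y) e = ∷-⊆ e (mono h X Y (drop-∷-⊆ e))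

  reflect : (h : m ≤ N) → Reflecting (f h)
  reflect z≤n     []      []      _ = id
  reflect (s≤s h) (_ ∷ X) (_ ∷ Y) e = ∷-⊆ e (reflect h X Y (drop-∷-⊆ e))

-- The cube in which the coordinates in W are free and the others are those of E.
place : (E W : Subset N) → Copy ∣ W ∣ N
place E W = copy (f E W) (mono E W) (reflect E W)
  where
  f : (E W : Subset N) → Subset ∣ W ∣ → Subset N
  f []      []            _       = []
  f (e ∷ E) (outside ∷ W) X       = e ∷ f E W X
  f (e ∷ E) (inside  ∷ W) (x ∷ X) = x ∷ f E W X

  mono : (E W : Subset N) → Monotone (f E W)
  mono []      []            _       _       _ = id
  mono (e ∷ E) (outside ∷ W) X       Y       h = s⊆s (mono E W X Y h)
  mono (e ∷ E) (inside  ∷ W) (_ ∷ X) (_ ∷ Y) h = ∷-⊆ h (mono E W X Y (drop-∷-⊆ h))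

  reflect : (E W : Subset N) → Reflecting (f E W)
  reflect []      []            []      []      _ = id
  reflect (e ∷ E) (outside ∷ W) X       Y       h = reflect E W X Y (drop-∷-⊆ h)
  reflect (e ∷ E) (inside  ∷ W) (_ ∷ X) (_ ∷ Y) h =
    ∷-⊆ h (reflect E W X Y (drop-∷-⊆ h))

place⁺ : ∀ {x} (E W : Subset N) X → x ∈ E → x ∉ W → x ∈ embed (place E W) X
place⁺ (_ ∷ E) (outside ∷ W) X       here      x∉W = here
place⁺ (_ ∷ E) (outside ∷ W) X       (there i) x∉W = there (place⁺ E W X i (x∉W ∘ there))
place⁺ (_ ∷ E) (inside  ∷ W) (_ ∷ X) here      x∉W = contradiction here x∉W
place⁺ (_ ∷ E) (inside  ∷ W) (_ ∷ X) (there i) x∉W = there (place⁺ E W X i (x∉W ∘ there))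

place⁻ : ∀ {x} (E W : Subset N) X → x ∈ embed (place E W) X → x ∉ W → x ∈ E
place⁻ (_ ∷ E) (outside ∷ W) X       here      x∉W = here
place⁻ (_ ∷ E) (outside ∷ W) X       (there i) x∉W = there (place⁻ E W X i (x∉W ∘ there))
place⁻ (_ ∷ E) (inside  ∷ W) (_ ∷ X) here      x∉W = contradiction here x∉W
place⁻ (_ ∷ E) (inside  ∷ W) (_ ∷ X) (there i) x∉W = there (place⁻ E W X i (x∉W ∘ there))

-- With the next three equations: `place ⊥ D` spans the interval from `⊥` to `D`, and
-- `place E (∁ E)` the interval from `E` to `⊤`. Restricting a coloring to them lets `D` or `E` act
-- as an end of a lattice.
place-⊥-⊥ : (D : Subset N) → embed (place ⊥ D) ⊥ ≡ ⊥
place-⊥-⊥ []            = refl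
place-⊥-⊥ (outside ∷ D) = cong (outside ∷_) (place-⊥-⊥ D)
place-⊥-⊥ (inside  ∷ D) = cong (outside ∷_) (place-⊥-⊥ D)

place-⊥-⊤ : (D : Subset N) → embed (place ⊥ D) ⊤ ≡ D
place-⊥-⊤ []            = refl
place-⊥-⊤ (outside ∷ D) = cong (outside ∷_) (place-⊥-⊤ D)
place-⊥-⊤ (inside  ∷ D) = cong (inside ∷_) (place-⊥-⊤ D)

place-∁-⊥ : (E : Subset N) → embed (place E (∁ E)) ⊥ ≡ E
place-∁-⊥ []            = refl
place-∁-⊥ (outside ∷ E) = cong (outside ∷_) (place-∁-⊥ E)
place-∁-⊥ (inside  ∷ E) = cong (inside ∷_) (place-∁-⊥ E)

place-∁-⊤ : (E : Subset N) → embed (place E (∁ E)) ⊤ ≡ ⊤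
place-∁-⊤ []            = refl
place-∁-⊤ (outside ∷ E) = cong (inside ∷_) (place-∁-⊤ E)
place-∁-⊤ (inside  ∷ E) = cong (inside ∷_) (place-∁-⊤ E)

-- Freeing every coordinate except `z` and `y` leaves a cube of dimension at least `N ∸ 2`; the base
-- set `⁅ z ⁆` keeps `z` in and, since `z ≢ y`, keeps `y` out.
slice : ∀ {z y : Fin N} → z ≢ y → 2 + m ≤ N →
        Σ[ φ ∈ Copy m N ] ∀ X → z ∈ embed φ X × y ∉ embed φ X
slice {N} {m} {z} {y} z≢y 2+m≤N =
  place ⁅ z ⁆ W ⊙ widen m≤∣W∣ , λ X →
    place⁺ ⁅ z ⁆ W _ (x∈⁅x⁆ z) (fixed (inj₁ (x∈⁅x⁆ z))) ,
    λ y∈ → z≢y (sym (x∈⁅y⁆⇒x≡y z (place⁻ ⁅ z ⁆ W _ y∈ (fixed (inj₂ (x∈⁅x⁆ y))))))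
  where
  W = ∁ (⁅ z ⁆ ∪ ⁅ y ⁆)

  fixed : ∀ {x} → x ∈ ⁅ z ⁆ ⊎ x ∈ ⁅ y ⁆ → x ∉ W
  fixed h = x∈p⇒x∉∁p (x∈p∪q⁺ h)

  ∣fixed∣≤2 : ∣ ⁅ z ⁆ ∪ ⁅ y ⁆ ∣ ≤ 2
  ∣fixed∣≤2 = subst₂ (λ i j → ∣ ⁅ z ⁆ ∪ ⁅ y ⁆ ∣ ≤ i + j) (∣⁅x⁆∣≡1 z) (∣⁅x⁆∣≡1 y)
                     (∣p∪q∣≤∣p∣+∣q∣ ⁅ z ⁆ ⁅ y ⁆)

  m≤∣W∣ : m ≤ ∣ W ∣
  m≤∣W∣ = subst (m ≤_) (sym (∣∁p∣≡n∸∣p∣ (⁅ z ⁆ ∪ ⁅ y ⁆)))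
                (ℕ.∸-mono 2+m≤N ∣fixed∣≤2)

-- The ends of the copy are always `⊥` and `⊤`, so incomparability of `Y` and `Z` is enough to make
-- it induced.
diamond : (Y Z : Subset N) → Y ⊈ Z → Z ⊈ Y → Copy 2 N
diamond {N} Y Z Y⊈Z Z⊈Y = copy f mono reflect
  where
  f : Subset 2 → Subset N
  f (outside ∷ outside ∷ []) = ⊥
  f (inside  ∷ outside ∷ []) = Y
  f (outside ∷ inside  ∷ []) = Z
  f (inside  ∷ inside  ∷ []) = ⊤

  mono : Monotone f
  mono (outside ∷ outside ∷ []) _                          h = ⊥-elim ∘ ∉⊥
  mono (inside  ∷ outside ∷ []) (inside  ∷ outside ∷ [])   h = id
  mono (outside ∷ inside  ∷ []) (outside ∷ inside  ∷ [])   h = id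
  mono _                        (inside  ∷ inside  ∷ [])   h = λ _ → ∈⊤
  mono (inside  ∷ _       ∷ []) (outside ∷ _       ∷ [])   h with () ← h here
  mono (_       ∷ inside  ∷ []) (_       ∷ outside ∷ [])   h with there () ← h (there here)

  reflect : Reflecting f
  reflect (outside ∷ outside ∷ []) _                        h = λ { (there (there ())) }
  reflect (inside  ∷ outside ∷ []) (inside  ∷ outside ∷ []) h = id
  reflect (outside ∷ inside  ∷ []) (outside ∷ inside  ∷ []) h = id
  reflect _                        (inside  ∷ inside  ∷ []) h = ⊆⊤
  reflect (inside  ∷ outside ∷ []) (outside ∷ outside ∷ []) h = ⊥-elim (Y⊈Z (⊥-elim ∘ ∉⊥ ∘ h))
  reflect (inside  ∷ outside ∷ []) (outside ∷ inside  ∷ []) h = ⊥-elim (Y⊈Z h)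
  reflect (outside ∷ inside  ∷ []) (outside ∷ outside ∷ []) h = ⊥-elim (Z⊈Y (⊥-elim ∘ ∉⊥ ∘ h))
  reflect (outside ∷ inside  ∷ []) (inside  ∷ outside ∷ []) h = ⊥-elim (Z⊈Y h)
  reflect (inside  ∷ inside  ∷ []) (outside ∷ outside ∷ []) h =
    ⊥-elim (Y⊈Z (λ {x} _ → ⊥-elim (∉⊥ (h {x} ∈⊤))))
  reflect (inside  ∷ inside  ∷ []) (inside  ∷ outside ∷ []) h = ⊥-elim (Z⊈Y (h ∘ const ∈⊤))
  reflect (inside  ∷ inside  ∷ []) (outside ∷ inside  ∷ []) h = ⊥-elim (Y⊈Z (h ∘ const ∈⊤))

chain : (X Y : Subset N) → X ⊆ Y → Y ⊈ X → Copy 1 N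
chain {N} X Y X⊆Y Y⊈X = copy f mono reflect
  where
  f : Subset 1 → Subset N
  f (outside ∷ []) = X
  f (inside  ∷ []) = Y

  mono : Monotone f
  mono (outside ∷ []) (outside ∷ []) h = id
  mono (outside ∷ []) (inside  ∷ []) h = X⊆Y
  mono (inside  ∷ []) (inside  ∷ []) h = id
  mono (inside  ∷ []) (outside ∷ []) h with () ← h here

  reflect : Reflecting f
  reflect (outside ∷ []) _              h = λ { (there ()) }
  reflect (inside  ∷ []) (inside  ∷ []) h = id
  reflect (inside  ∷ []) (outside ∷ []) h = ⊥-elim (Y⊈X h)

-- A maximal chain of `𝓑 n` is sent to a strictly increasing chain, and each of its `n` steps adds
-- an element.
∣embed⊥∣+n≤∣embed⊤∣ : (φ : Copy n N) → ∣ embed φ ⊥ ∣ + n ≤ ∣ embed φ ⊤ ∣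
∣embed⊥∣+n≤∣embed⊤∣ {zero}  φ = ℕ.≤-reflexive (ℕ.+-identityʳ _)
∣embed⊥∣+n≤∣embed⊤∣ {suc n} φ = begin
  ∣ embed φ ⊥ ∣ + suc n     ≡⟨ ℕ.+-suc _ n ⟩
  suc (∣ embed φ ⊥ ∣ + n)   ≤⟨ s≤s (∣embed⊥∣+n≤∣embed⊤∣ (φ ⊙ cons outside)) ⟩
  suc ∣ embed φ (outside ∷ ⊤) ∣
    ≤⟨ p⊂q⇒∣p∣<∣q∣ (⊆∧⊉⇒⊂ (embed-mono φ (outside ∷ ⊤) ⊤ ⊆⊤) top⊈) ⟩
  ∣ embed φ ⊤ ∣             ∎
  where
  open ℕ.≤-Reasoning

  top⊈ : embed φ ⊤ ⊈ embed φ (outside ∷ ⊤)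
  top⊈ h with () ← embed-reflect φ ⊤ (outside ∷ ⊤) h here

-- Decidability

_≟ˢ_ : (X Y : Subset n) → Dec (X ≡ Y)
_≟ˢ_ = ≡-dec _≟ᵇ_

allSubsets? : {P : Subset n → Set} → Decidable P → Dec (∀ X → P X)
allSubsets? P? = map′
  (λ ¬∃ X → decidable-stable (P? X) (λ ¬p → ¬∃ (X , ¬p)))
  (λ p (X , ¬p) → ¬p (p X))
  (¬? (anySubset? (¬? ∘ P?)))

Searchable : Set → Set₁
Searchable A = {P : A → Set} → Decidable P → Dec (∃ P)

-- Functions are searched through their tables, which determine them only pointwise; predicates on
-- them therefore have to respect `≗`.
Extensional : {A : Set} → ((Subset n → A) → Set) → Set
Extensional Q = ∀ {f g} → f ≗ g → Q f → Q g

-- A function on `Subset (suc n)` is a pair of functions on the two halves of the cube, so two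
-- nested searches suffice.
anyFunction? : {A : Set} → Searchable A → {Q : (Subset n → A) → Set} →
               Extensional Q → Decidable Q → Dec (∃ Q)
anyFunction? {zero} any {Q} ext Q? = map′
  (λ (a , q) → const a , q)
  (λ (f , q) → f [] , ext (λ { [] → refl }) q)
  (any (λ a → Q? (const a)))
anyFunction? {suc n} {A} any {Q} ext Q? = map′
  (λ (f , g , q) → glue f g , q)
  (λ (f , q) → f ∘ (outside ∷_) , f ∘ (inside ∷_) ,
               ext (λ { (outside ∷ _) → refl ; (inside ∷ _) → refl }) q)
  (anyFunction? any
    (λ f≗f′ → map₂ (λ {g} → ext (glue-cong f≗f′ (λ _ → refl))))
    (λ f → anyFunction? any
      (λ g≗g′ → ext (glue-cong {f} (λ _ → refl) g≗g′))
      (λ g → Q? (glue f g))))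
  where
  glue : (f g : Subset n → A) → Subset (suc n) → A
  glue f g (outside ∷ X) = f X
  glue f g (inside  ∷ X) = g X

  glue-cong : ∀ {f f′ g g′} → f ≗ f′ → g ≗ g′ → glue f g ≗ glue f′ g′
  glue-cong e e′ (outside ∷ X) = e X
  glue-cong e e′ (inside  ∷ X) = e′ X

allFunctions? : {A : Set} → Searchable A → {Q : (Subset n → A) → Set} →
                Extensional Q → Decidable Q → Dec (∀ f → Q f)
allFunctions? any ext Q? = map′
  (λ ¬∃ f → decidable-stable (Q? f) (λ ¬q → ¬∃ (f , ¬q)))
  (λ q (f , ¬q) → ¬q (q f))
  (¬? (anyFunction? any (λ f≗g ¬q q → ¬q (ext (sym ∘ f≗g) q)) (¬? ∘ Q?)))

anyCopy? : {Q : (Subset m → Subset N) → Set} → Extensional Q → Decidable Q →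
           Dec (∃[ φ ] Q (embed φ))
anyCopy? {Q = Q} ext Q? = map′
  (λ (f , mono , reflect , q) → copy f mono reflect , q)
  (λ (φ , q) → embed φ , embed-mono φ , embed-reflect φ , q)
  (anyFunction? anySubset?
    (λ f≗g (mono , reflect , q) →
      (λ X Y h → subst₂ _⊆_ (f≗g X) (f≗g Y) (mono X Y h)) ,
      (λ X Y h → reflect X Y (subst₂ _⊆_ (sym (f≗g X)) (sym (f≗g Y)) h)) ,
      ext f≗g q)
    (λ f →
      allSubsets? (λ X → allSubsets? (λ Y → (X ⊆? Y) →-dec (f X ⊆? f Y))) ×-dec
      allSubsets? (λ X → allSubsets? (λ Y → (f X ⊆? f Y) →-dec (X ⊆? Y))) ×-dec
      Q? f))

monochromatic? : (n : ℕ) (χ : Coloring k N) → Dec (∃[ f ] Monochromatic (𝓑 n) χ f)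
monochromatic? n χ = anyCopy?
  {Q = λ f → ∀ X Y → χ (f X) ≡ χ (f Y)}
  (λ f≗g mono X Y → subst₂ (λ U V → χ U ≡ χ V) (f≗g X) (f≗g Y) (mono X Y))
  (λ f → allSubsets? (λ X → allSubsets? (λ Y → χ (f X) ≟ χ (f Y))))

rainbow? : (n : ℕ) (χ : Coloring k N) → Dec (∃[ f ] Rainbow (𝓑 n) χ f)
rainbow? n χ = map′
  (map₂ (λ inj → inj _ _))
  (map₂ (λ inj X Y → inj))
  (anyCopy?
    {Q = λ f → ∀ X Y → χ (f X) ≡ χ (f Y) → X ≡ Y}
    (λ f≗g inj X Y eq →
      inj X Y (subst₂ (λ U V → χ U ≡ χ V) (sym (f≗g X)) (sym (f≗g Y)) eq))
    (λ f → allSubsets? (λ X → allSubsets? (λ Y →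
      (χ (f X) ≟ χ (f Y)) →-dec (X ≟ˢ Y)))))

-- Compares colorings with different palettes: monochromatic copies pass to the coarser coloring,
-- rainbow copies to the finer one.
Refines : Coloring k N → Coloring l N → Set
Refines χ χ′ = ∀ X Y → χ X ≡ χ Y → χ′ X ≡ χ′ Y

≗⇒refines : {χ χ′ : Coloring k N} → χ ≗ χ′ → Refines χ χ′
≗⇒refines e X Y = subst₂ _≡_ (e X) (e Y)

mono-refines : {χ : Coloring k N} {χ′ : Coloring l N} → Refines χ χ′ →
               (∃[ f ] Monochromatic (𝓑 n) χ f) → ∃[ f ] Monochromatic (𝓑 n) χ′ f
mono-refines ref (f , mono) = f , λ X Y → ref _ _ (mono X Y)

rainbow-refines : {χ : Coloring k N} {χ′ : Coloring l N} → Refines χ χ′ →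
                  (∃[ f ] Rainbow (𝓑 n) χ′ f) → ∃[ f ] Rainbow (𝓑 n) χ f
rainbow-refines ref (f , inj) = f , inj ∘ ref _ _

ramsey? : (k n : ℕ) → Decidable (RamseyProperty k (𝓑 n))
ramsey? k n N = allFunctions? any?
  (λ e → mono-refines (≗⇒refines e)) (monochromatic? n)

code : Subset n → Fin (2 ^ n)
code []            = zero
code (outside ∷ X) = combine {2} zero (code X)
code (inside  ∷ X) = combine {2} (suc zero) (code X)

code-injective : (X Y : Subset n) → code X ≡ code Y → X ≡ Y
code-injective []            []            eq = refl
code-injective (outside ∷ X) (outside ∷ Y) eq =
  cong (outside ∷_) (code-injective X Y
    (proj₂ (combine-injective {2} zero (code X) zero (code Y) eq)))
code-injective (inside ∷ X) (inside ∷ Y) eq =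
  cong (inside ∷_) (code-injective X Y
    (proj₂ (combine-injective {2} (suc zero) (code X) (suc zero) (code Y) eq)))
code-injective (outside ∷ X) (inside ∷ Y) eq
  with () ← proj₁ (combine-injective {2} zero (code X) (suc zero) (code Y) eq)
code-injective (inside ∷ X) (outside ∷ Y) eq
  with () ← proj₁ (combine-injective {2} (suc zero) (code X) zero (code Y) eq)

-- 2 ^ N colors suffice: replace a color by a set having that color.
recolor : (χ : Coloring k N) → ∃[ χ′ ] Refines {l = 2 ^ N} χ χ′ × Refines χ′ χ
recolor {k} {N} χ =
  code ∘ representative ∘ χ ,
  (λ X Y → cong (code ∘ representative)) ,
  λ X Y eq → trans (sym (has-color X))
    (trans (cong χ (code-injective _ _ eq)) (has-color Y))
  where
  representative : Fin k → Subset N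
  representative c with anySubset? (λ X → χ X ≟ c)
  ... | yes (X , _) = X
  ... | no _        = ⊥

  has-color : ∀ X → χ (representative (χ X)) ≡ χ X
  has-color X with anySubset? (λ Y → χ Y ≟ χ X)
  ... | yes (_ , eq) = eq
  ... | no ∄         = contradiction (X , refl) ∄

-- The unbounded quantifier over `k` reduces to `k = 2 ^ N`: `recolor` keeps the color classes, so
-- both kinds of copies transfer back.
rainbowRamsey? : (m n : ℕ) → Decidable (RainbowRamseyProperty (𝓑 m) (𝓑 n))
rainbowRamsey? m n N = map′
  (λ prop k χ → let χ′ , ref , ref′ = recolor χ in
    Sum.map (rainbow-refines ref) (mono-refines ref′) (prop χ′))
  (λ prop → prop (2 ^ N))
  (allFunctions? any?
    (λ e → Sum.map (rainbow-refines (≗⇒refines (sym ∘ e)))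
                   (mono-refines (≗⇒refines e)))
    (λ χ → rainbow? m χ ⊎-dec monochromatic? n χ))

smallest : {A : ℕ → Set} → Decidable A → ∀ m → A m → ∃ (IsSmallest A)
smallest A? zero    a = zero , a , λ _ _ → z≤n
smallest A? (suc m) a with A? zero
... | yes a₀ = zero , a₀ , λ _ _ → z≤n
... | no ¬a₀ with smallest (A? ∘ suc) m a
...   | i , aᵢ , least = suc i , aᵢ , λ
  { zero    a₀ → contradiction a₀ ¬a₀
  ; (suc j) aⱼ → s≤s (least j aⱼ)
  }

-- Finiteness of the Ramsey numbers

-- This is `n * 2 ^ m`, written by doubling so that the two halves of the sets indexing the blobs
-- correspond to the two sides of `++`.
blobs : ℕ → ℕ → ℕ
blobs n zero    = n
blobs n (suc m) = blobs n m + blobs n m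

-- Each X ⊆ [m] owns a blob of n coordinates.  If the cube of no blob avoids R,
-- then g X consists of all blobs of sets earlier in the lexicographic order and
-- of a suitable part of the blob of X.
section : {R : Subset m → Subset (blobs n m) → Set} → (∀ X Y → Dec (R X Y)) →
          (∃[ X ] Σ[ φ ∈ Copy n (blobs n m) ] ∀ Y → ¬ R X (embed φ Y)) ⊎
          (∃[ g ] Monotone g × ∀ X → R X (g X))
section {zero} {R = R} R? with anySubset? (R? [])
... | yes (Y , r) = inj₂ (const Y , (λ _ _ _ → id) , λ { [] → r })
... | no ∄        = inj₁ ([] , identity , λ Y r → ∄ (Y , r))
section {suc m} {n} {R} R?
  with section {R = λ X Y → R (outside ∷ X) (Y ++ ⊥)} (λ _ _ → R? _ _)
     | section {R = λ X Y → R (inside ∷ X) (⊤ {blobs n m} ++ Y)} (λ _ _ → R? _ _)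
... | inj₁ (X , φ , ¬r)      | _                    = inj₁ (outside ∷ X , append ⊥ ⊙ φ , ¬r)
... | inj₂ _                 | inj₁ (X , φ , ¬r)    = inj₁ (inside ∷ X , prepend ⊤ ⊙ φ , ¬r)
... | inj₂ (g₀ , mono₀ , r₀) | inj₂ (g₁ , mono₁ , r₁) = inj₂ (g , mono , holds)
  where
  g : Subset (suc m) → Subset (blobs n (suc m))
  g (outside ∷ X) = g₀ X ++ ⊥
  g (inside  ∷ X) = ⊤ {blobs n m} ++ g₁ X

  mono : Monotone g
  mono (outside ∷ X) (outside ∷ Y) h = ++-⊆ (g₀ X) (g₀ Y) (mono₀ X Y (drop-∷-⊆ h)) id
  mono (outside ∷ X) (inside  ∷ Y) h = ++-⊆ (g₀ X) ⊤ ⊆⊤ ⊥⊆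
  mono (inside  ∷ X) (inside  ∷ Y) h = ++-⊆ (⊤ {blobs n m}) ⊤ id (mono₁ X Y (drop-∷-⊆ h))
  mono (inside  ∷ X) (outside ∷ Y) h with () ← h here

  holds : ∀ X → R X (g X)
  holds (outside ∷ X) = r₀ X
  holds (inside  ∷ X) = r₁ X

-- Apply `section` to the relation "`X ++ Y` does not have color `zero`". Either some blob carries a
-- cube of color `zero`, or the graph of `g` is a copy of `𝓑 m` that avoids `zero` and hence uses
-- only `k` colors.
ramsey-suc : RamseyProperty k (𝓑 n) m → RamseyProperty (suc k) (𝓑 n) (m + blobs n m)
ramsey-suc {k} {n} {m} prop χ
  with section {m} {n} (λ X Y → ¬? (zero ≟ χ (X ++ Y)))
... | inj₁ (X , φ , zeros) =
  prepend X ⊙ φ , λ Y Z → trans (sym (is-zero Y)) (is-zero Z)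
  where
  is-zero : ∀ Y → zero ≡ χ (X ++ embed φ Y)
  is-zero Y = decidable-stable (zero ≟ χ (X ++ embed φ Y)) (zeros Y)
... | inj₂ (g , mono , nonzero) =
  graph ⊙ proj₁ (prop χ′) ,
  λ Y Z → punchOut-injective (nonzero _) (nonzero _) (proj₂ (prop χ′) Y Z)
  where
  graph : Copy m (m + blobs n m)
  graph = copy (λ X → X ++ g X)
    (λ X Y h → ++-⊆ X Y h (mono X Y h))
    (λ X Y → ++-⊆⁻ˡ X Y (g X) (g Y))

  χ′ : Coloring k m
  χ′ X = punchOut (nonzero X)

ramsey-number-finite : ∀ k n → ∃ (RamseyProperty k (𝓑 n))
ramsey-number-finite zero    n = 0 , λ χ → contradiction (χ ⊥) λ ()
ramsey-number-finite (suc k) n =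
  let m , prop = ramsey-number-finite k n in m + blobs n m , ramsey-suc prop

-- The lower bounds

vertex : Fin 4 → Subset 2
vertex zero                   = outside ∷ outside ∷ []
vertex (suc zero)             = outside ∷ inside  ∷ []
vertex (suc (suc zero))       = inside  ∷ outside ∷ []
vertex (suc (suc (suc zero))) = inside  ∷ inside  ∷ []

code-vertex : ∀ i → code (vertex i) ≡ i
code-vertex zero                   = refl
code-vertex (suc zero)             = refl
code-vertex (suc (suc zero))       = refl
code-vertex (suc (suc (suc zero))) = refl

-- Pigeonhole: a rainbow `𝓑 2` would inject its four vertices into three colors.
rainbow⇒ramsey : RainbowRamseyProperty (𝓑 2) (𝓑 n) N → RamseyProperty 3 (𝓑 n) N
rainbow⇒ramsey prop χ with prop 3 χ
... | inj₂ mono      = mono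
... | inj₁ (f , inj) =
  contradiction (injective⇒≤ (vertex-injective ∘ inj)) (ℕ.<⇒≱ ℕ.≤-refl)
  where
  vertex-injective : ∀ {i j} → vertex i ≡ vertex j → i ≡ j
  vertex-injective {i} {j} eq = trans (sym (code-vertex i)) (trans (cong code eq) (code-vertex j))

-- Color `X` by `∣ X ∣ / n`; for `r < k * n` this uses at most `k` colors. Each class spans `n`
-- consecutive sizes, while the bottom and top of a copy of `𝓑 n` differ in size by at least `n`.
k*n≤ramsey : .{{_ : NonZero n}} → RamseyProperty k (𝓑 n) r → k * n ≤ r
k*n≤ramsey {n} {k} {r} prop = ℕ.≮⇒≥ λ r<kn →
  let
    band : Subset r → ℕ
    band X = ∣ X ∣ / n

    band<k : ∀ X → band X < k
    band<k X = m<n*o⇒m/o<n (ℕ.≤-<-trans (∣p∣≤n X) r<kn)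

    φ , mono = prop (λ X → fromℕ< (band<k X))

    lower = ∣ embed φ ⊥ ∣
    upper = ∣ embed φ ⊤ ∣

    lower+n≤upper : lower + n ≤ upper
    lower+n≤upper = ∣embed⊥∣+n≤∣embed⊤∣ φ

    band-eq : lower / n ≡ upper / n
    band-eq = fromℕ<-injective _ _ (band<k (embed φ ⊥)) (band<k (embed φ ⊤)) (mono ⊥ ⊤)
  in ℕ.<-irrefl band-eq (begin-strict
    lower / n             ≤⟨ /-monoˡ-≤ n (ℕ.m+n≤o⇒m≤o∸n lower lower+n≤upper) ⟩
    (upper ∸ n) / n       <⟨ ℕ.n<1+n _ ⟩
    1 + (upper ∸ n) / n   ≡⟨ m/n≡1+[m∸n]/n (ℕ.≤-trans (ℕ.m≤n+m n lower) lower+n≤upper) ⟨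
    upper / n             ∎)
  where open ℕ.≤-Reasoning

-- The upper bound

NoRainbowDiamond : Coloring k N → Set
NoRainbowDiamond χ = ¬ (∃[ f ] Rainbow (𝓑 2) χ f)

NoMonochromatic : ℕ → Coloring k N → Set
NoMonochromatic n χ = ¬ (∃[ f ] Monochromatic (𝓑 n) χ f)

module _ (χ : Coloring k N) (φ : Copy M N) where

  pull-noRainbow : NoRainbowDiamond χ → NoRainbowDiamond (χ ∘ embed φ)
  pull-noRainbow none (f , inj) = none (φ ⊙ f , inj)

  pull-noMonochromatic : NoMonochromatic n χ → NoMonochromatic n (χ ∘ embed φ)
  pull-noMonochromatic none (f , mono) = none (φ ⊙ f , mono)

-- Colorings with at most three colors

module _ {A : Set} {a b c : A} where

  OneOf : A → Set
  OneOf x = (x ≡ a ⊎ x ≡ b) ⊎ x ≡ c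

  -- If some of `a`, `b`, `c` coincide, one color may receive several labels; what matters is the
  -- converse, that equal labels force equal colors.
  index : ∀ {x} → OneOf x → Fin 3
  index (inj₁ (inj₁ _)) = zero
  index (inj₁ (inj₂ _)) = suc zero
  index (inj₂ _)        = suc (suc zero)

  index-injective : ∀ {x y} (p : OneOf x) (q : OneOf y) → index p ≡ index q → x ≡ y
  index-injective (inj₁ (inj₁ x≡a)) (inj₁ (inj₁ y≡a)) _ = trans x≡a (sym y≡a)
  index-injective (inj₁ (inj₂ x≡b)) (inj₁ (inj₂ y≡b)) _ = trans x≡b (sym y≡b)
  index-injective (inj₂ x≡c)        (inj₂ y≡c)        _ = trans x≡c (sym y≡c)
  index-injective (inj₂ _)          (inj₁ (inj₁ _))   ()
  index-injective (inj₂ _)          (inj₁ (inj₂ _))   ()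

fewColors : RamseyProperty 3 (𝓑 n) r → r ≤ N → (χ : Coloring k N) → NoMonochromatic n χ →
             ∀ a b c → ¬ (∀ X → OneOf {a = a} {b} {c} (χ X))
fewColors prop r≤N χ noMono a b c few =
  let f , mono = prop (λ X → index (few (embed (widen r≤N) X))) in
  noMono (widen r≤N ⊙ f , λ X Y → index-injective (few _) (few _) (mono X Y))

-- Colorings whose ends have different colors

module _ {χ : Coloring k N} (noRainbow : NoRainbowDiamond χ) (ends : χ ⊥ ≢ χ ⊤) where

  Extreme : Subset N → Set
  Extreme X = χ X ≡ χ ⊥ ⊎ χ X ≡ χ ⊤

  extreme? : Decidable Extreme
  extreme? X = (χ X ≟ χ ⊥) ⊎-dec (χ X ≟ χ ⊤)

  -- Otherwise `⊥`, `Y`, `Z`, `⊤` would form a rainbow diamond.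
  incomparable⇒same : ∀ {Y Z} → Y ⊈ Z → Z ⊈ Y → ¬ Extreme Y → ¬ Extreme Z → χ Y ≡ χ Z
  incomparable⇒same {Y} {Z} Y⊈Z Z⊈Y ¬eY ¬eZ =
    decidable-stable (χ Y ≟ χ Z) λ Y≢Z → noRainbow (diamond Y Z Y⊈Z Z⊈Y , λ {U} {V} → inj Y≢Z U V)
    where
    f = embed (diamond Y Z Y⊈Z Z⊈Y)

    inj : χ Y ≢ χ Z → ∀ U V → χ (f U) ≡ χ (f V) → U ≡ V
    inj Y≢Z (outside ∷ outside ∷ []) (outside ∷ outside ∷ []) eq = refl
    inj Y≢Z (outside ∷ outside ∷ []) (inside  ∷ outside ∷ []) eq = contradiction (inj₁ (sym eq)) ¬eY
    inj Y≢Z (outside ∷ outside ∷ []) (outside ∷ inside  ∷ []) eq = contradiction (inj₁ (sym eq)) ¬eZ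
    inj Y≢Z (outside ∷ outside ∷ []) (inside  ∷ inside  ∷ []) eq = contradiction eq ends
    inj Y≢Z (inside  ∷ outside ∷ []) (outside ∷ outside ∷ []) eq = contradiction (inj₁ eq) ¬eY
    inj Y≢Z (inside  ∷ outside ∷ []) (inside  ∷ outside ∷ []) eq = refl
    inj Y≢Z (inside  ∷ outside ∷ []) (outside ∷ inside  ∷ []) eq = contradiction eq Y≢Z
    inj Y≢Z (inside  ∷ outside ∷ []) (inside  ∷ inside  ∷ []) eq = contradiction (inj₂ eq) ¬eY
    inj Y≢Z (outside ∷ inside  ∷ []) (outside ∷ outside ∷ []) eq = contradiction (inj₁ eq) ¬eZ
    inj Y≢Z (outside ∷ inside  ∷ []) (inside  ∷ outside ∷ []) eq = contradiction (sym eq) Y≢Z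
    inj Y≢Z (outside ∷ inside  ∷ []) (outside ∷ inside  ∷ []) eq = refl
    inj Y≢Z (outside ∷ inside  ∷ []) (inside  ∷ inside  ∷ []) eq = contradiction (inj₂ eq) ¬eZ
    inj Y≢Z (inside  ∷ inside  ∷ []) (outside ∷ outside ∷ []) eq = contradiction (sym eq) ends
    inj Y≢Z (inside  ∷ inside  ∷ []) (inside  ∷ outside ∷ []) eq = contradiction (inj₂ (sym eq)) ¬eY
    inj Y≢Z (inside  ∷ inside  ∷ []) (outside ∷ inside  ∷ []) eq = contradiction (inj₂ (sym eq)) ¬eZ
    inj Y≢Z (inside  ∷ inside  ∷ []) (inside  ∷ inside  ∷ []) eq = refl

  ExtremeSlice : Set
  ExtremeSlice = ∃[ z ] ∃[ y ] z ≢ y × ∀ X → z ∈ X → y ∉ X → Extreme X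

  -- A set that contains z ∉ Z and misses y ∈ Y is incomparable to both Y and Z.
  nested⇒extremeSlice : ∀ {Y Z} → Y ⊆ Z → ¬ Extreme Y → ¬ Extreme Z → χ Y ≢ χ Z → ExtremeSlice
  nested⇒extremeSlice {Y} {Z} Y⊆Z ¬eY ¬eZ Y≢Z with nonempty? Y | nonempty? (∁ Z)
  ... | no empty | _ = contradiction (inj₁ (cong χ (Empty-unique empty))) ¬eY
  ... | _ | no empty = contradiction (inj₂ (cong χ Z≡⊤)) ¬eZ
    where
    Z≡⊤ : Z ≡ ⊤
    Z≡⊤ = ⊆-antisym ⊆⊤ (λ {x} _ → x∉∁p⇒x∈p (λ x∈∁Z → empty (x , x∈∁Z)))
  ... | yes (y , y∈Y) | yes (z , z∈∁Z) = z , y , z≢y , λ X z∈X y∉X →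
    decidable-stable (extreme? X) λ ¬eX → Y≢Z (trans
      (incomparable⇒same (λ Y⊆X → y∉X (Y⊆X y∈Y)) (λ X⊆Y → z∉Z (Y⊆Z (X⊆Y z∈X))) ¬eY ¬eX)
      (incomparable⇒same (λ X⊆Z → z∉Z (X⊆Z z∈X)) (λ Z⊆X → y∉X (Z⊆X (Y⊆Z y∈Y))) ¬eX ¬eZ))
    where
    z∉Z : z ∉ Z
    z∉Z = x∈∁p⇒x∉p z∈∁Z

    z≢y : z ≢ y
    z≢y refl = z∉Z (Y⊆Z y∈Y)

  dichotomy : (∃[ c ] ∀ X → Extreme X ⊎ χ X ≡ c) ⊎ ExtremeSlice
  dichotomy with anySubset? (¬? ∘ extreme?)
  -- No further color occurs at all, and `χ ⊥` fills the place of `c`.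
  ... | no ∄ = inj₁ (χ ⊥ , λ X → inj₁ (decidable-stable (extreme? X) (λ ¬eX → ∄ (X , ¬eX))))
  ... | yes (Y , ¬eY) with anySubset? (λ Z → ¬? (extreme? Z ⊎-dec (χ Z ≟ χ Y)))
  ...   | no ∄ = inj₁ (χ Y , λ X →
            decidable-stable (extreme? X ⊎-dec (χ X ≟ χ Y)) (λ ¬p → ∄ (X , ¬p)))
  ...   | yes (Z , ¬p) with Y ⊆? Z | Z ⊆? Y
  ...     | yes Y⊆Z | _       = inj₂ (nested⇒extremeSlice Y⊆Z ¬eY (¬p ∘ inj₁) (¬p ∘ inj₂ ∘ sym))
  ...     | no _    | yes Z⊆Y = inj₂ (nested⇒extremeSlice Z⊆Y (¬p ∘ inj₁) ¬eY (¬p ∘ inj₂))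
  ...     | no Y⊈Z  | no Z⊈Y  =
            contradiction (inj₂ (sym (incomparable⇒same Y⊈Z Z⊈Y ¬eY (¬p ∘ inj₁)))) ¬p

-- If the ends differed, `dichotomy` would leave three colors on the whole lattice or two colors on
-- a slice. The summand 2 pays for the two coordinates that the slice fixes, so its dimension can
-- still be `r`.
ends-agree : RamseyProperty 3 (𝓑 n) r → 2 + r ≤ N → (χ : Coloring k N) →
             NoRainbowDiamond χ → NoMonochromatic n χ → χ ⊥ ≡ χ ⊤
ends-agree prop 2+r≤N χ noRainbow noMono = decidable-stable (χ ⊥ ≟ χ ⊤) λ ends →
  case dichotomy noRainbow ends of λ where
    (inj₁ (c , few)) → fewColors prop (ℕ.m+n≤o⇒n≤o 2 2+r≤N) χ noMono _ _ c few
    (inj₂ (z , y , z≢y , ext)) →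
      let φ , φ∈ = slice z≢y 2+r≤N in
      fewColors prop ℕ.≤-refl (χ ∘ embed φ) (pull-noMonochromatic χ φ noMono)
        -- Only two colors occur on the slice; the third entry repeats the first.
        (χ ⊥) (χ ⊤) (χ ⊥) (λ X → let z∈ , y∉ = φ∈ X in inj₁ (ext _ z∈ y∉))

-- The cases n = 1, n = 2 and n ≥ 3

-- Without a monochromatic `𝓑 1`, any two nested sets differ in color, so `a`, `b`, `bc` all avoid
-- the colors of the ends. As `a` is incomparable to `b` and to `bc`, all three share a color,
-- although `b ⊂ bc`.
upper-bound₁ : 3 ≤ N → (χ : Coloring k N) → NoRainbowDiamond χ → ¬ NoMonochromatic 1 χ
upper-bound₁ {N} {k} 3≤N χ noRainbow noMono =
  differ b⊆bc bc⊈b (trans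
    (same b⊈a a⊈ b-mid a-mid)
    (same a⊈ bc⊈a a-mid bc-mid))
  where
  χ₃ : Coloring k 3
  χ₃ = χ ∘ embed (widen 3≤N)

  differ : ∀ {X Y} → X ⊆ Y → Y ⊈ X → χ₃ X ≢ χ₃ Y
  differ {X} {Y} X⊆Y Y⊈X eq =
    pull-noMonochromatic χ (widen 3≤N) noMono (chain X Y X⊆Y Y⊈X , λ
      { (outside ∷ []) (outside ∷ []) → refl
      ; (outside ∷ []) (inside  ∷ []) → eq
      ; (inside  ∷ []) (outside ∷ []) → sym eq
      ; (inside  ∷ []) (inside  ∷ []) → refl
      })

  a b bc : Subset 3
  a  = inside  ∷ outside ∷ outside ∷ []
  b  = outside ∷ inside  ∷ outside ∷ []
  bc = outside ∷ inside  ∷ inside  ∷ []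

  ends : χ₃ ⊥ ≢ χ₃ ⊤
  ends = differ ⊆⊤ λ h → ∉⊥ (h {zero} here)

  Middle : Subset 3 → Set
  Middle X = ¬ Extreme (pull-noRainbow χ (widen 3≤N) noRainbow) ends X

  middle : ∀ {X} → X ⊈ ⊥ → ⊤ ⊈ X → Middle X
  middle X⊈⊥ ⊤⊈X (inj₁ eq) = differ ⊥⊆ X⊈⊥ (sym eq)
  middle X⊈⊥ ⊤⊈X (inj₂ eq) = differ ⊆⊤ ⊤⊈X eq

  same : ∀ {Y Z} → Y ⊈ Z → Z ⊈ Y → Middle Y → Middle Z → χ₃ Y ≡ χ₃ Z
  same = incomparable⇒same (pull-noRainbow χ (widen 3≤N) noRainbow) ends

  a⊈ : ∀ {X : Subset 2} → a ⊈ outside ∷ X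
  a⊈ h with () ← h here

  b⊈a : b ⊈ a
  b⊈a h with there () ← h (there here)

  bc⊈a : bc ⊈ a
  bc⊈a h with there () ← h (there here)

  b⊆bc : b ⊆ bc
  b⊆bc = s⊆s (s⊆s ⊥⊆)

  bc⊈b : bc ⊈ b
  bc⊈b h with there (there ()) ← h (there (there here))

  a-mid : Middle a
  a-mid = middle a⊈ (λ h → b⊈a (h ∘ const ∈⊤))

  b-mid : Middle b
  b-mid = middle (λ h → b⊈a (⊥-elim ∘ ∉⊥ ∘ h)) (λ h → a⊈ {_ ∷ _ ∷ []} (h ∘ const ∈⊤))

  bc-mid : Middle bc
  bc-mid = middle (λ h → bc⊈a (⊥-elim ∘ ∉⊥ ∘ h)) (λ h → a⊈ (h ∘ const ∈⊤))

∣⊤∣≥ : m ≤ n → m ≤ ∣ ⊤ {n} ∣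
∣⊤∣≥ = subst (_ ≤_) (sym (∣⊤∣≡n _))

upper-bound₂ : RamseyProperty 3 (𝓑 2) r → 2 + r ≤ N → (χ : Coloring k N) →
               NoRainbowDiamond χ → ¬ NoMonochromatic 2 χ
upper-bound₂ {r} {suc (suc N)} {k} prop 2+r≤N@(s≤s (s≤s r≤N)) χ noRainbow noMono =
  let D , r<∣D∣ , D≢⊥ = coatom in below D r<∣D∣ D≢⊥
  where
  ends : χ ⊥ ≡ χ ⊤
  ends = ends-agree prop 2+r≤N χ noRainbow noMono

  -- Since the ends agree, a second set of their color incomparable to the first would complete a
  -- monochromatic diamond.
  incomparable⇒⊥ : ∀ {Y Z} → Y ⊈ Z → Z ⊈ Y → χ Y ≡ χ ⊥ → χ Z ≢ χ ⊥
  incomparable⇒⊥ {Y} {Z} Y⊈Z Z⊈Y Y≡ Z≡ =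
    noMono (diamond Y Z Y⊈Z Z⊈Y , λ U V → trans (bottom U) (sym (bottom V)))
    where
    bottom : ∀ U → χ (embed (diamond Y Z Y⊈Z Z⊈Y) U) ≡ χ ⊥
    bottom (outside ∷ outside ∷ []) = refl
    bottom (inside  ∷ outside ∷ []) = Y≡
    bottom (outside ∷ inside  ∷ []) = Z≡
    bottom (inside  ∷ inside  ∷ []) = sym ends

  -- Two coatoms are incomparable, so they cannot both have the color of `⊥`.
  coatom : ∃[ D ] r < ∣ D ∣ × χ D ≢ χ ⊥
  coatom with χ (outside ∷ ⊤) ≟ χ ⊥
  ... | no ≢⊥  = outside ∷ ⊤ , s≤s (∣⊤∣≥ r≤N) , ≢⊥
  ... | yes ≡⊥ = inside ∷ outside ∷ ⊤ , s≤s (∣⊤∣≥ r≤N) ,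
    incomparable⇒⊥ (λ h → case h (there here) of λ { (there ()) })
                   (λ h → case h here of λ ()) ≡⊥

  -- A 4-cube in two colors, one of which is that of ⊥, splits off two mutually
  -- incomparable 2-cubes, one of which avoids the color of ⊥.
  twoColors : (θ : Copy 4 (2 + N)) → ∀ b → ¬ (∀ X → χ (embed θ X) ≡ χ ⊥ ⊎ χ (embed θ X) ≡ b)
  twoColors θ b two with anySubset? (λ X → χ (embed θ (inside ∷ outside ∷ X)) ≟ χ ⊥)
  ... | no ∄ = noMono (θ ⊙ cons inside ⊙ cons outside ,
    λ X Y → trans (is-b X) (sym (is-b Y)))
    where
    is-b : ∀ X → χ (embed θ (inside ∷ outside ∷ X)) ≡ b
    is-b X = Sum.fromInj₂ (λ eq → contradiction (X , eq) ∄) (two _)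
  ... | yes (X , ≡⊥) = noMono (θ ⊙ cons outside ⊙ cons inside ,
    λ Y Z → trans (is-b Y) (sym (is-b Z)))
    where
    is-b : ∀ Y → χ (embed θ (outside ∷ inside ∷ Y)) ≡ b
    is-b Y = Sum.fromInj₂
      (λ eq → contradiction eq (incomparable⇒⊥
        (λ h → case embed-reflect θ _ _ h here of λ ())
        (λ h → case embed-reflect θ (outside ∷ inside ∷ Y) (inside ∷ outside ∷ X) h (there here)
               of λ { (there ()) })
        ≡⊥))
      (two _)

  -- The interval below `D` would have ends of different colors, so `dichotomy` applies to it: few
  -- colors contradict `prop`, and an extreme slice contradicts `twoColors`.
  below : ∀ D → r < ∣ D ∣ → ¬ χ D ≢ χ ⊥
  below D r<∣D∣ D≢⊥ with dichotomy {χ = χ ∘ embed (place ⊥ D)}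
      (pull-noRainbow χ (place ⊥ D) noRainbow)
      (λ eq → D≢⊥ (sym (subst₂ (λ X Y → χ X ≡ χ Y) (place-⊥-⊥ D) (place-⊥-⊤ D) eq)))
  ... | inj₁ (c , few) =
    fewColors prop (ℕ.<⇒≤ r<∣D∣) (χ ∘ embed (place ⊥ D))
      (pull-noMonochromatic χ (place ⊥ D) noMono) _ _ c few
  ... | inj₂ (z , y , z≢y , ext) =
    -- The lower bound gives `6 ≤ r`; fixing two coordinates leaves the dimension 4 that `twoColors`
    -- asks for.
    let φ , φ∈ = slice z≢y (ℕ.≤-trans (k*n≤ramsey prop) (ℕ.<⇒≤ r<∣D∣)) in
    twoColors (place ⊥ D ⊙ φ) (χ D) λ X → let z∈ , y∉ = φ∈ X in
      subst₂ (λ U V → χ (embed (place ⊥ D ⊙ φ) X) ≡ χ U ⊎ χ (embed (place ⊥ D ⊙ φ) X) ≡ χ V)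
        (place-⊥-⊥ D) (place-⊥-⊤ D) (ext _ z∈ y∉)

-- The copy sends `X` to `block X ++ X`. The block of `r` coordinates is empty while `X` has at most
-- `n - 2` elements and full afterwards, which jumps over the middle sizes whose colors are unknown.
upper-bound₃ : RamseyProperty 3 (𝓑 (3 + m)) r → (χ : Coloring k (r + (3 + m))) →
               NoRainbowDiamond χ → ¬ NoMonochromatic (3 + m) χ
upper-bound₃ {m} {r} {k} prop χ noRainbow noMono =
  noMono (copy f mono (λ X Y → ++-⊆⁻ʳ (block X) (block Y)) ,
          λ X Y → trans (bottom X) (sym (bottom Y)))
  where
  K = r + (3 + m)

  2+r≤K : 2 + r ≤ K
  2+r≤K = subst (_≤ K) (ℕ.+-comm r 2) (ℕ.+-monoʳ-≤ r (s≤s (s≤s z≤n)))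

  ends : χ ⊥ ≡ χ ⊤
  ends = ends-agree prop 2+r≤K χ noRainbow noMono

  -- `ends-agree` applied to the interval from `⊥` to `D`.
  large : ∀ D → 2 + r ≤ ∣ D ∣ → χ D ≡ χ ⊥
  large D 2+r≤∣D∣ = sym (subst₂ (λ X Y → χ X ≡ χ Y) (place-⊥-⊥ D) (place-⊥-⊤ D)
    (ends-agree prop 2+r≤∣D∣ (χ ∘ embed (place ⊥ D))
      (pull-noRainbow χ (place ⊥ D) noRainbow)
      (pull-noMonochromatic χ (place ⊥ D) noMono)))

  -- `ends-agree` applied to the interval from `E` to `⊤` gives the color of `⊤`, which is that of
  -- `⊥` by `ends`.
  small : ∀ E → ∣ E ∣ ≤ 1 + m → χ E ≡ χ ⊥
  small E ∣E∣≤ = trans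
    (subst₂ (λ X Y → χ X ≡ χ Y) (place-∁-⊥ E) (place-∁-⊤ E)
      (ends-agree prop 2+r≤∣∁E∣ (χ ∘ embed (place E (∁ E)))
        (pull-noRainbow χ (place E (∁ E)) noRainbow)
        (pull-noMonochromatic χ (place E (∁ E)) noMono)))
    (sym ends)
    where
    2+r≤∣∁E∣ : 2 + r ≤ ∣ ∁ E ∣
    2+r≤∣∁E∣ = begin
      2 + r                       ≡⟨ ℕ.+-comm 2 r ⟩
      r + 2                       ≡⟨ ℕ.m+n∸n≡m (r + 2) (1 + m) ⟨
      r + 2 + (1 + m) ∸ (1 + m)   ≡⟨ cong (_∸ (1 + m)) (ℕ.+-assoc r 2 (1 + m)) ⟩
      K ∸ (1 + m)                 ≤⟨ ℕ.∸-monoʳ-≤ K ∣E∣≤ ⟩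
      K ∸ ∣ E ∣                   ≡⟨ ∣∁p∣≡n∸∣p∣ E ⟨
      ∣ ∁ E ∣                     ∎
      where open ℕ.≤-Reasoning

  -- The decision is an explicit argument so that later proofs can match on it.
  fill : {X : Subset (3 + m)} → Dec (∣ X ∣ ≤ 1 + m) → Subset r
  fill (yes _) = ⊥
  fill (no _)  = ⊤

  block : Subset (3 + m) → Subset r
  block X = fill {X} (∣ X ∣ ℕ.≤? 1 + m)

  f : Subset (3 + m) → Subset K
  f X = block X ++ X

  mono : Monotone f
  mono X Y X⊆Y = ++-⊆ (block X) (block Y)
    (fill-mono (∣ X ∣ ℕ.≤? 1 + m) (∣ Y ∣ ℕ.≤? 1 + m)) X⊆Y
    where
    fill-mono : ∀ X? Y? → fill {X} X? ⊆ fill {Y} Y?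
    fill-mono (yes _) _        = ⊥⊆
    fill-mono (no _)  (no _)   = id
    fill-mono (no X≰) (yes Y≤) = contradiction (ℕ.≤-trans (p⊆q⇒∣p∣≤∣q∣ X⊆Y) Y≤) X≰

  bottom : ∀ X → χ (f X) ≡ χ ⊥
  bottom X = fill-bottom (∣ X ∣ ℕ.≤? 1 + m)
    where
    size : ∀ p → ∣ p ++ X ∣ ≡ ∣ p ∣ + ∣ X ∣
    size p = ∣p++q∣≡∣p∣+∣q∣ {m = r} p X

    fill-bottom : ∀ X? → χ (fill {X} X? ++ X) ≡ χ ⊥
    fill-bottom (yes X≤) = small (⊥ ++ X)
      (subst (_≤ 1 + m) (sym (trans (size ⊥) (cong (_+ ∣ X ∣) (∣⊥∣≡0 r)))) X≤)
    fill-bottom (no X≰)  = large (⊤ ++ X)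
      (subst₂ _≤_ (ℕ.+-comm r 2) (sym (trans (size ⊤) (cong (_+ ∣ X ∣) (∣⊤∣≡n r))))
        -- Here `∣ X ∣` is at least `2 + m`, hence at least 2, and a full block raises the size to
        -- `r + 2` or more.
        (ℕ.+-monoʳ-≤ r (ℕ.≤-trans (s≤s (s≤s z≤n)) (ℕ.≰⇒> X≰))))

upper-bound : 1 ≤ n → RamseyProperty 3 (𝓑 n) r → (χ : Coloring k (r + n)) →
              NoRainbowDiamond χ → ¬ NoMonochromatic n χ
upper-bound {1} {r} _ prop = upper-bound₁ (ℕ.≤-trans (k*n≤ramsey prop) (ℕ.m≤m+n r 1))
upper-bound {2} {r} _ prop = upper-bound₂ prop (ℕ.≤-reflexive (ℕ.+-comm 2 r))
upper-bound {suc (suc (suc _))} _ prop = upper-bound₃ prop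

-- Both kinds of copies can be searched for, so refuting their joint absence yields one of them.
ramsey⇒rainbow : 1 ≤ n → RamseyProperty 3 (𝓑 n) r → RainbowRamseyProperty (𝓑 2) (𝓑 n) (r + n)
ramsey⇒rainbow {n} 1≤n prop k χ = decidable-stable
  (rainbow? 2 χ ⊎-dec monochromatic? n χ)
  (λ none → upper-bound 1≤n prop χ (none ∘ inj₁) (none ∘ inj₂))

theorem1p6 : (n : ℕ) → 1 ≤ n →
    ∃[ r ] ∃[ rr ] (R 3 [ 𝓑 n ]≔ r) × (RR[ 𝓑 2 ∶ 𝓑 n ]≔ rr) × r ≤ rr × rr ≤ r + n
theorem1p6 n 1≤n =
  let M , propᴹ                    = ramsey-number-finite 3 n
      r , R≔r@(prop , r-least)     = smallest (ramsey? 3 n) M propᴹ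
      rainbow-prop                 = ramsey⇒rainbow 1≤n prop
      rr , RR≔rr@(prop′ , rr-least) = smallest (rainbowRamsey? 2 n) (r + n) rainbow-prop
  -- Each inequality is the minimality of one number, tested at a dimension where the other property
  -- supplies its own.
  in r , rr , R≔r , RR≔rr , r-least rr (rainbow⇒ramsey prop′) , rr-least (r + n) rainbow-prop
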